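{- Let $d$ be a Dyck path and $k\ge1$. Then $\mathrm{supp}(X_{G(d)}(x_1,\ldots,x_k))\subset\mathbb{N}^k$ is M-convex.
   Context: A Dyck path $d$ of length $n$ is a lattice path from $(0,0)$ to $(n,n)$ with steps $\mathsf{n}=(0,1)$ and $\mathsf{e}=(1,0)$ not going below $y=x$. Its Hessenberg function $h_d:[n]\to[n]$ is: $h_d(i)$ is the number of unit squares in column $i$ below $d$, i.e. the number of $\mathsf n$ steps preceding the $i$-th $\mathsf e$ step. The indifference graph $G(d)$ has vertex set $[n]$ with an edge between $i<j$ iff $j\le h_d(i)$. For a graph $G$, $X_G(x_1,\ldots,x_k)=\sum_f\prod_{v\in V(G)}x_{f(v)}$, summed over all proper colorings $f:V(G)\to[k]$ (adjacent vertices get different colors). The support $\mathrm{supp}(p)$ of a polynomial $p$ is the set of exponent vectors of monomials with nonzero coefficient. A set $J\subset\mathbb{N}^k$ is M-convex if for all $\alpha,\beta\in J$ and all $i$ with $\alpha_i>\beta_i$ there is $j$ with $\beta_j>\alpha_j$ and $\alpha-e_i+e_j\in J$, where $e_i$ are the standard unit vectors. -}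

module Defs where

open import Data.Bool using (if_then_else_)
open import Data.Fin using (Fin; toℕ)
import Data.Fin as Fin
import Data.Fin.Properties as Fin
open import Data.Integer using (ℤ; 0ℤ; 1ℤ)
import Data.Integer as ℤ
open import Data.List using (List; []; _∷_; [_]; _++_; map; foldr; filter; allFin; cartesianProductWith)
open import Data.Nat using (ℕ; zero; suc; _+_; _∸_; _≤_; _>_; _<?_)
open import Data.Product using (_×_; _,_; ∃-syntax)
open import Data.Sum using (_⊎_; inj₁; inj₂; swap)
open import Data.Vec using (Vec; []; _∷_; lookup; replicate; zipWith; _[_]≔_)
open import Data.Vec.Properties using (≡-dec)
import Data.Nat.Properties as ℕ
open import Level using (0ℓ)
open import Relation.Binary using (Rel; Decidable; Symmetric; Irreflexive)
open import Relation.Binary.PropositionalEquality using (_≡_; _≢_; refl)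
open import Relation.Nullary using (Dec; does; ¬?; _×-dec_; _⊎-dec_; _→-dec_)
open import Relation.Unary using (Pred; _∈_)

data Step : Set where
  𝗇 𝖾 : Step

#𝗇 : List Step → ℕ
#𝗇 []      = 0
#𝗇 (𝗇 ∷ w) = suc (#𝗇 w)
#𝗇 (𝖾 ∷ w) = #𝗇 w

#𝖾 : List Step → ℕ
#𝖾 []      = 0
#𝖾 (𝗇 ∷ w) = #𝖾 w
#𝖾 (𝖾 ∷ w) = suc (#𝖾 w)

-- After the steps u the path from (0,0) is at the point (#𝖾 u , #𝗇 u).
record DyckPath (n : ℕ) : Set where
  field
    steps  : List Step
    end-x  : #𝖾 steps ≡ n
    end-y  : #𝗇 steps ≡ n
    above  : ∀ u v → steps ≡ u ++ v → #𝖾 u ≤ #𝗇 u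

-- The number of 𝗇 steps before the 𝖾 step with index i, counting from 0.
-- If there is no such step the value is the total number of 𝗇 steps.
𝗇-before-𝖾 : List Step → ℕ → ℕ
𝗇-before-𝖾 []      i       = 0
𝗇-before-𝖾 (𝗇 ∷ w) i       = suc (𝗇-before-𝖾 w i)
𝗇-before-𝖾 (𝖾 ∷ w) zero    = 0
𝗇-before-𝖾 (𝖾 ∷ w) (suc i) = 𝗇-before-𝖾 w i

-- The set [n] is represented by Fin n, with i : Fin n standing for
-- suc (toℕ i) ∈ [n]; the value of the Hessenberg function is the actual
-- number in [n], not shifted.
hessenberg : ∀ {n} → DyckPath n → Fin n → ℕ
hessenberg d i = 𝗇-before-𝖾 (DyckPath.steps d) (toℕ i)

record Graph (n : ℕ) : Set₁ where
  field
    Adj     : Rel (Fin n) 0ℓ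
    adj?    : Decidable Adj
    symm    : Symmetric Adj
    irrefl  : Irreflexive _≡_ Adj

-- In terms of elements of [n], the second component says suc (toℕ j) ≤ h i.
Edge : ∀ {n} → DyckPath n → Rel (Fin n) 0ℓ
Edge d i j = (i Fin.< j) × (suc (toℕ j) ≤ hessenberg d i)

indifferenceGraph : ∀ {n} → DyckPath n → Graph n
indifferenceGraph {n} d = record
  { Adj    = λ i j → Edge d i j ⊎ Edge d j i
  ; adj?   = λ i j → edge? i j ⊎-dec edge? j i
  ; symm   = swap
  ; irrefl = irr
  }
  where
  edge? : Decidable (Edge d)
  edge? i j = (i Fin.<? j) ×-dec (toℕ j <? hessenberg d i)

  irr : Irreflexive _≡_ (λ i j → Edge d i j ⊎ Edge d j i)
  irr refl (inj₁ (i<i , _)) = ℕ.<-irrefl refl i<i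
  irr refl (inj₂ (i<i , _)) = ℕ.<-irrefl refl i<i

Exponent : ℕ → Set
Exponent k = Vec ℕ k

e : ∀ {k} → Fin k → Exponent k
e i = replicate _ 0 [ i ]≔ 1

_⊕_ _⊖_ : ∀ {k} → Exponent k → Exponent k → Exponent k
_⊕_ = zipWith _+_
_⊖_ = zipWith _∸_

infixl 6 _⊕_ _⊖_

-- A polynomial in ℤ[x₁,…,x_k] is a formal sum of terms c·x^α, in which the
-- same exponent may occur repeatedly and c may be 0.  It is therefore only
-- determined through its coefficients coeff p α, which collect like terms.
Polynomial : ℕ → Set
Polynomial k = List (ℤ × Exponent k)

coeff : ∀ {k} → Polynomial k → Exponent k → ℤ
coeff []            α = 0ℤ
coeff ((c , β) ∷ p) α = (if does (≡-dec ℕ._≟_ β α) then c else 0ℤ) ℤ.+ coeff p α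

supp : ∀ {k} → Polynomial k → Pred (Exponent k) 0ℓ
supp p α = coeff p α ≢ 0ℤ

x : ∀ {k} → Fin k → Polynomial k
x i = [ (1ℤ , e i) ]

0ᴾ 1ᴾ : ∀ {k} → Polynomial k
0ᴾ = []
1ᴾ = [ (1ℤ , replicate _ 0) ]

_+ᴾ_ _*ᴾ_ : ∀ {k} → Polynomial k → Polynomial k → Polynomial k
_+ᴾ_ = _++_
_*ᴾ_ = cartesianProductWith λ (c , α) (c′ , β) → (c ℤ.* c′ , α ⊕ β)

Σᴾ Πᴾ : ∀ {k} → List (Polynomial k) → Polynomial k
Σᴾ = foldr _+ᴾ_ 0ᴾ
Πᴾ = foldr _*ᴾ_ 1ᴾ

-- A map f : Fin n → Fin k is represented by its vector of values, so that
-- distinct entries of allColorings are distinct maps.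
Coloring : ℕ → ℕ → Set
Coloring n k = Vec (Fin k) n

allColorings : ∀ n k → List (Coloring n k)
allColorings zero    k = [ [] ]
allColorings (suc n) k = cartesianProductWith _∷_ (allFin k) (allColorings n k)

module _ {n : ℕ} (G : Graph n) where
  open Graph G

  Proper : ∀ {k} → Coloring n k → Set
  Proper f = ∀ u v → Adj u v → lookup f u ≢ lookup f v

  proper? : ∀ {k} (f : Coloring n k) → Dec (Proper f)
  proper? f = Fin.all? λ u → Fin.all? λ v →
    adj? u v →-dec ¬? (lookup f u Fin.≟ lookup f v)

  chromaticSymmetricPolynomial : (k : ℕ) → Polynomial k
  chromaticSymmetricPolynomial k =
    Σᴾ (map (λ f → Πᴾ (map (λ v → x (lookup f v)) (allFin n)))
            (filter proper? (allColorings n k)))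

-- The truncated subtraction in α ⊖ e i is exact, since lookup α i > 0.
MConvex : ∀ {k} → Pred (Exponent k) 0ℓ → Set
MConvex {k} J =
  ∀ α β → α ∈ J → β ∈ J → ∀ (i : Fin k) → lookup α i > lookup β i →
  ∃[ j ] (lookup β j > lookup α j × (α ⊖ e i) ⊕ e j ∈ J)

{-# OPTIONS --safe #-}

-- The exponents α in the support are the colour counts of proper colourings.
-- Two facts describe them.  Transfer: if colour p is used more often than q,
-- one unit can be moved from p to q, by exchanging the two colours on an
-- initial segment of the vertices.  Greedy maximum: for every priority order of
-- the colours, the first-fit colouring maximises simultaneously the number of
-- vertices receiving one of the top colours, because a vertex rejected by the
-- top colours closes a clique in which all of these colours occur.
-- By transfers from the greedy counts one reaches every γ that is dominated by
-- them on all initial segments of the order (Muirhead).  For the exchange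
-- property, order the colours by decreasing α, with i last among its ties, and
-- let j be the last colour with β j > α j.  A segment containing j but not i has
-- β ≤ α outside, strictly at i, so its β-count exceeds its α-count and leaves
-- room for α - e_i + e_j, which is therefore dominated by the greedy counts.
module Submission where

open import Data.Bool using (if_then_else_)
open import Data.Empty using (⊥)
open import Data.Fin using (Fin; zero; suc; toℕ; fromℕ<)
import Data.Fin as Fin
open import Data.Fin.Permutation.Components using (transpose)
import Data.Fin.Properties as Fin
open import Data.Integer using (0ℤ; 1ℤ)
import Data.Integer as ℤ
import Data.Integer.Properties as ℤ
open import Data.List as List using (List; []; _∷_; [_]; foldr; filter; allFin)
open import Data.List.Membership.Propositional using () renaming (_∈_ to _∈ₗ_)
open import Data.List.Membership.Propositional.Properties
  using (∈-allFin; ∈-cartesianProductWith⁺; ∈-filter⁺; ∈-filter⁻)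
import Data.List.Properties as List
open import Data.List.Relation.Unary.Any using (here; there)
open import Data.Nat
open import Data.Nat.Induction using (<-wellFounded)
open import Data.Nat.Properties
open import Data.Product using (_×_; _,_; ∃-syntax; proj₂)
open import Data.Sum using (_⊎_; inj₁; inj₂)
open import Data.Vec using (Vec; []; _∷_; lookup; replicate; tabulate)
import Data.Vec.Properties as Vec
open import Function using (_∘_; _$_; id)
open import Induction.WellFounded using (Acc; acc)
open import Level using (0ℓ)
open import Relation.Binary using (Tri; tri<; tri≈; tri>)
open import Relation.Binary.PropositionalEquality hiding ([_])
open import Relation.Nullary using (Dec; yes; no; does; ¬_; ¬?; contradiction; _×-dec_)
open import Relation.Nullary.Decidable using (dec-true; dec-false; decidable-stable)
open import Relation.Unary using (Pred; Decidable; _∈_)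
open import Algebra.Properties.Semiring.Sum +-*-semiring
  using (sum; sum-cong-≗; ∑-distrib-+)
open import Defs

private variable
  k n : ℕ
  P Q : Set

-- Indicators, weighted sums over the colours, and shifts of one unit.

𝟙 : Dec P → ℕ
𝟙 d = if does d then 1 else 0

𝟙-cases : (d : Dec P) → (P × 𝟙 d ≡ 1) ⊎ (¬ P × 𝟙 d ≡ 0)
𝟙-cases (yes p) = inj₁ (p , refl)
𝟙-cases (no ¬p) = inj₂ (¬p , refl)

𝟙-yes : (d : Dec P) → P → 𝟙 d ≡ 1
𝟙-yes (yes _) p = refl
𝟙-yes (no ¬p) p = contradiction p ¬p

𝟙-no : (d : Dec P) → ¬ P → 𝟙 d ≡ 0
𝟙-no (yes p) ¬p = contradiction p ¬p
𝟙-no (no _)  ¬p = refl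

𝟙-≤1 : (d : Dec P) → 𝟙 d ≤ 1
𝟙-≤1 (yes _) = ≤-refl
𝟙-≤1 (no _)  = z≤n

𝟙-⇔ : (d : Dec P) (d′ : Dec Q) → (P → Q) → (Q → P) → 𝟙 d ≡ 𝟙 d′
𝟙-⇔ (yes p) d′ P→Q Q→P = sym (𝟙-yes d′ (P→Q p))
𝟙-⇔ (no ¬p) d′ P→Q Q→P = sym (𝟙-no d′ (¬p ∘ Q→P))

δ : Fin k → Fin k → ℕ
δ p b = 𝟙 (p Fin.≟ b)

δ-refl : (p : Fin k) → δ p p ≡ 1
δ-refl p = 𝟙-yes (p Fin.≟ p) refl

δ-≢ : {p q : Fin k} → p ≢ q → δ p q ≡ 0
δ-≢ {p = p} {q} = 𝟙-no (p Fin.≟ q)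

sum-mono-≤ : (f g : Fin k → ℕ) → (∀ b → f b ≤ g b) → sum f ≤ sum g
sum-mono-≤ {zero}  f g f≤g = z≤n
sum-mono-≤ {suc k} f g f≤g = +-mono-≤ (f≤g zero) (sum-mono-≤ (f ∘ suc) (g ∘ suc) (f≤g ∘ suc))

sum-mono-< : (f g : Fin k → ℕ) → (∀ b → f b ≤ g b) → ∀ q → f q < g q → sum f < sum g
sum-mono-< f g f≤g zero    fq<gq = +-mono-<-≤ fq<gq (sum-mono-≤ (f ∘ suc) (g ∘ suc) (f≤g ∘ suc))
sum-mono-< f g f≤g (suc q) fq<gq = +-mono-≤-< (f≤g zero) (sum-mono-< (f ∘ suc) (g ∘ suc) (f≤g ∘ suc) q fq<gq)

⟨_,_⟩ : (Fin k → ℕ) → (Fin k → ℕ) → ℕ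
⟨ s , a ⟩ = sum (λ b → s b * a b)

⟨,⟩-congʳ : (s : Fin k → ℕ) {a a′ : Fin k → ℕ} → a ≗ a′ → ⟨ s , a ⟩ ≡ ⟨ s , a′ ⟩
⟨,⟩-congʳ s a≗a′ = sum-cong-≗ (λ b → cong (s b *_) (a≗a′ b))

⟨,⟩-+ : (s a a′ : Fin k → ℕ) → ⟨ s , (λ b → a b + a′ b) ⟩ ≡ ⟨ s , a ⟩ + ⟨ s , a′ ⟩
⟨,⟩-+ s a a′ = trans (sum-cong-≗ (λ b → *-distribˡ-+ (s b) (a b) (a′ b)))
                     (∑-distrib-+ (λ b → s b * a b) (λ b → s b * a′ b))

⟨,⟩-0 : (s : Fin k → ℕ) → ⟨ s , (λ _ → 0) ⟩ ≡ 0
⟨,⟩-0 {zero}  s = refl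
⟨,⟩-0 {suc k} s = cong₂ _+_ (*-zeroʳ (s zero)) (⟨,⟩-0 (s ∘ suc))

⟨,⟩-δ : (s : Fin k → ℕ) (p : Fin k) → ⟨ s , δ p ⟩ ≡ s p
⟨,⟩-δ s zero    = trans (cong₂ _+_ (*-identityʳ (s zero)) (⟨,⟩-0 (s ∘ suc))) (+-identityʳ (s zero))
⟨,⟩-δ s (suc p) = cong₂ _+_ (*-zeroʳ (s zero)) (⟨,⟩-δ (s ∘ suc) p)

⟨1,⟩ : (a : Fin k → ℕ) → ⟨ (λ _ → 1) , a ⟩ ≡ sum a
⟨1,⟩ a = sum-cong-≗ (λ b → *-identityˡ (a b))

-- α′ = α - e_p + e_q
record Shift (p q : Fin k) (α α′ : Fin k → ℕ) : Set where
  constructor shifting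
  field at : ∀ b → α′ b + δ p b ≡ α b + δ q b
open Shift

-- Pairing with `s` is additive, so the equations of `Shift` can be summed over the colours. Both
-- units are added, never subtracted, which keeps everything exact in ℕ.
⟨,⟩-Shift : (s : Fin k → ℕ) {p q : Fin k} {α α′ : Fin k → ℕ} → Shift p q α α′ →
            ⟨ s , α′ ⟩ + s p ≡ ⟨ s , α ⟩ + s q
⟨,⟩-Shift s {p} {q} {α} {α′} shift = begin
  ⟨ s , α′ ⟩ + s p              ≡⟨ cong (⟨ s , α′ ⟩ +_) (⟨,⟩-δ s p) ⟨
  ⟨ s , α′ ⟩ + ⟨ s , δ p ⟩      ≡⟨ ⟨,⟩-+ s α′ (δ p) ⟨
  ⟨ s , (λ b → α′ b + δ p b) ⟩  ≡⟨ ⟨,⟩-congʳ s (shift .at) ⟩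
  ⟨ s , (λ b → α b + δ q b) ⟩   ≡⟨ ⟨,⟩-+ s α (δ q) ⟩
  ⟨ s , α ⟩ + ⟨ s , δ q ⟩       ≡⟨ cong (⟨ s , α ⟩ +_) (⟨,⟩-δ s q) ⟩
  ⟨ s , α ⟩ + s q               ∎
  where open ≡-Reasoning

sum-Shift : {p q : Fin k} {α α′ : Fin k → ℕ} → Shift p q α α′ → sum α′ ≡ sum α
sum-Shift {α = α} {α′} shift = +-cancelʳ-≡ 1 _ _ (begin
  sum α′ + 1                ≡⟨ cong (_+ 1) (⟨1,⟩ α′) ⟨
  ⟨ (λ _ → 1) , α′ ⟩ + 1    ≡⟨ ⟨,⟩-Shift (λ _ → 1) shift ⟩
  ⟨ (λ _ → 1) , α ⟩ + 1     ≡⟨ cong (_+ 1) (⟨1,⟩ α) ⟩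
  sum α + 1                 ∎)
  where open ≡-Reasoning

-- Extremal colours and upper level sets of a priority.

argmin : (σ : Fin k → ℕ) {Q : Pred (Fin k) 0ℓ} → Decidable Q → ∀ q → Q q →
         ∃[ p ] (Q p × (∀ b → Q b → σ p ≤ σ b))
argmin σ {Q} Q? q₀ Qq₀ = go q₀ Qq₀ (<-wellFounded (σ q₀))
  where
  go : ∀ q → Q q → Acc _<_ (σ q) → ∃[ p ] (Q p × (∀ b → Q b → σ p ≤ σ b))
  go q Qq (acc rs) with Fin.any? (λ b → Q? b ×-dec (σ b <? σ q))
  ... | yes (b , Qb , σb<σq) = go b Qb (rs σb<σq)
  ... | no ∄                 = q , Qq , λ b Qb → ≮⇒≥ (λ σb<σq → ∄ (b , Qb , σb<σq))

≤-sum : (f : Fin k → ℕ) → ∀ b → f b ≤ sum f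
≤-sum f zero    = m≤m+n _ _
≤-sum f (suc b) = ≤-trans (≤-sum (f ∘ suc) b) (m≤n+m _ _)

argmax : (σ : Fin k → ℕ) {Q : Pred (Fin k) 0ℓ} → Decidable Q → ∀ q → Q q →
         ∃[ p ] (Q p × (∀ b → Q b → σ b ≤ σ p))
-- `sum σ` bounds every `σ b`, so the truncated subtraction reverses the order faithfully.
argmax σ Q? q Qq with argmin (λ b → sum σ ∸ σ b) Q? q Qq
... | p , Qp , p-min = p , Qp , λ b Qb → ∸-cancelʳ-≤ (≤-sum σ b) (p-min b Qb)

-- Indicator of the upper level set {b : σ b ≥ m}.
above : (Fin k → ℕ) → ℕ → Fin k → ℕ
above σ m b = 𝟙 (m ≤? σ b)

-- The witness p minimises σ, so that γ b ≥ λ′ b for all b with m₀ ≤ σ b < σ p.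
surplus : (σ : Fin k → ℕ) {γ λ′ : Fin k → ℕ} (m₀ : ℕ) →
          ⟨ above σ m₀ , γ ⟩ ≤ ⟨ above σ m₀ , λ′ ⟩ →
          ∀ q → m₀ ≤ σ q → λ′ q < γ q →
          ∃[ p ] (m₀ ≤ σ p × γ p < λ′ p ×
            (∀ m → σ q < m → m ≤ σ p → ⟨ above σ m , γ ⟩ < ⟨ above σ m , λ′ ⟩))
surplus σ {γ} {λ′} m₀ γ≤λ q m₀≤σq λq<γq
  with Fin.any? (λ b → (m₀ ≤? σ b) ×-dec (γ b <? λ′ b))
-- Without such a colour, `λ′ ≤ γ` on the whole level set of `m₀`, strictly at `q`, against the
-- assumed inequality.
... | no ∄ = contradiction γ≤λ (<⇒≱ (sum-mono-< _ _ pointwise q strictAt-q))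
  where
  pointwise : ∀ b → above σ m₀ b * λ′ b ≤ above σ m₀ b * γ b
  pointwise b with 𝟙-cases (m₀ ≤? σ b)
  ... | inj₁ (m₀≤σb , eq) rewrite eq = *-monoʳ-≤ 1 (≮⇒≥ (λ γb<λb → ∄ (b , m₀≤σb , γb<λb)))
  ... | inj₂ (_ , eq)     rewrite eq = z≤n
  strictAt-q : above σ m₀ q * λ′ q < above σ m₀ q * γ q
  strictAt-q rewrite 𝟙-yes (m₀ ≤? σ q) m₀≤σq = *-monoʳ-< 1 λq<γq
... | yes (p₀ , Qp₀)
  with argmin σ (λ b → (m₀ ≤? σ b) ×-dec (γ b <? λ′ b)) p₀ Qp₀
...   | p , (m₀≤σp , γp<λp) , p-min = p , m₀≤σp , γp<λp , tight
  where
  -- The level sets of `m₀` and `m` differ by the colours with `m₀ ≤ σ b < m`. These lie below `p`,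
  -- so `λ′ ≤ γ` there by minimality, strictly at `q`. Adding the sums crosswise expresses this
  -- without subtraction.
  tight : ∀ m → σ q < m → m ≤ σ p → ⟨ above σ m , γ ⟩ < ⟨ above σ m , λ′ ⟩
  tight m σq<m m≤σp = +-cancelˡ-< ⟨ above σ m₀ , λ′ ⟩ _ _ $ begin-strict
    ⟨ above σ m₀ , λ′ ⟩ + ⟨ above σ m , γ ⟩
      ≡⟨ ∑-distrib-+ (λ b → above σ m₀ b * λ′ b) (λ b → above σ m b * γ b) ⟨
    sum (λ b → above σ m₀ b * λ′ b + above σ m b * γ b)
      <⟨ sum-mono-< _ _ pointwise q strictAt-q ⟩
    sum (λ b → above σ m₀ b * γ b + above σ m b * λ′ b)
      ≡⟨ ∑-distrib-+ (λ b → above σ m₀ b * γ b) (λ b → above σ m b * λ′ b) ⟩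
    ⟨ above σ m₀ , γ ⟩ + ⟨ above σ m , λ′ ⟩
      ≤⟨ +-monoˡ-≤ _ γ≤λ ⟩
    ⟨ above σ m₀ , λ′ ⟩ + ⟨ above σ m , λ′ ⟩  ∎
    where
    open ≤-Reasoning
    pointwise : ∀ b → above σ m₀ b * λ′ b + above σ m b * γ b ≤ above σ m₀ b * γ b + above σ m b * λ′ b
    pointwise b with 𝟙-cases (m₀ ≤? σ b) | 𝟙-cases (m ≤? σ b)
    ... | inj₁ (_ , eq₀) | inj₁ (_ , eq) rewrite eq₀ | eq = ≤-reflexive (+-comm (1 * λ′ b) (1 * γ b))
    ... | inj₁ (m₀≤σb , eq₀) | inj₂ (m≰σb , eq) rewrite eq₀ | eq =
      +-monoˡ-≤ 0 (*-monoʳ-≤ 1 (≮⇒≥ (λ γb<λb → m≰σb (≤-trans m≤σp (p-min b (m₀≤σb , γb<λb))))))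
    ... | inj₂ (m₀≰σb , eq₀) | inj₁ (m≤σb , eq) =
      contradiction (≤-trans m₀≤σq (≤-trans (<⇒≤ σq<m) m≤σb)) m₀≰σb
    ... | inj₂ (_ , eq₀) | inj₂ (_ , eq) rewrite eq₀ | eq = z≤n
    strictAt-q : above σ m₀ q * λ′ q + above σ m q * γ q < above σ m₀ q * γ q + above σ m q * λ′ q
    strictAt-q rewrite 𝟙-yes (m₀ ≤? σ q) m₀≤σq | 𝟙-no (m ≤? σ q) (<⇒≱ σq<m) = +-monoˡ-< 0 (*-monoʳ-< 1 λq<γq)

-- Values of a shifted exponent.

Shift-p : {p q : Fin k} {α α′ : Fin k → ℕ} → Shift p q α α′ → p ≢ q → suc (α′ p) ≡ α p
Shift-p {p = p} {q} {α} {α′} shift p≢q = begin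
  suc (α′ p)      ≡⟨ +-comm 1 (α′ p) ⟩
  α′ p + 1        ≡⟨ cong (α′ p +_) (δ-refl p) ⟨
  α′ p + δ p p    ≡⟨ shift .at p ⟩
  α p + δ q p     ≡⟨ cong (α p +_) (δ-≢ (p≢q ∘ sym)) ⟩
  α p + 0         ≡⟨ +-identityʳ (α p) ⟩
  α p             ∎
  where open ≡-Reasoning

Shift-≢q : {p q : Fin k} {α α′ : Fin k → ℕ} → Shift p q α α′ → ∀ {b} → q ≢ b → α′ b ≤ α b
Shift-≢q {p = p} {q} {α} {α′} shift {b} q≢b = begin
  α′ b         ≤⟨ m≤m+n (α′ b) (δ p b) ⟩
  α′ b + δ p b ≡⟨ shift .at b ⟩
  α b + δ q b  ≡⟨ cong (α b +_) (δ-≢ q≢b) ⟩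
  α b + 0      ≡⟨ +-identityʳ (α b) ⟩
  α b          ∎
  where open ≤-Reasoning

Shift-≢p : {p q : Fin k} {α α′ : Fin k → ℕ} → Shift p q α α′ → ∀ {b} → p ≢ b → α b ≤ α′ b
Shift-≢p {p = p} {q} {α} {α′} shift {b} p≢b = begin
  α b          ≤⟨ m≤m+n (α b) (δ q b) ⟩
  α b + δ q b  ≡⟨ shift .at b ⟨
  α′ b + δ p b ≡⟨ cong (α′ b +_) (δ-≢ p≢b) ⟩
  α′ b + 0     ≡⟨ +-identityʳ (α′ b) ⟩
  α′ b         ∎
  where open ≤-Reasoning

Shift-≤suc : {p q : Fin k} {α α′ : Fin k → ℕ} → Shift p q α α′ → ∀ b → α′ b ≤ suc (α b)
Shift-≤suc {p = p} {q} {α} {α′} shift b = begin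
  α′ b         ≤⟨ m≤m+n (α′ b) (δ p b) ⟩
  α′ b + δ p b ≡⟨ shift .at b ⟩
  α b + δ q b  ≤⟨ +-monoʳ-≤ (α b) (𝟙-≤1 (q Fin.≟ b)) ⟩
  α b + 1      ≡⟨ +-comm (α b) 1 ⟩
  suc (α b)    ∎
  where open ≤-Reasoning

Shift-q : {p q : Fin k} {α α′ : Fin k → ℕ} → Shift p q α α′ → p ≢ q → α′ q ≡ suc (α q)
Shift-q {p = p} {q} {α} {α′} shift p≢q = begin
  α′ q            ≡⟨ +-identityʳ (α′ q) ⟨
  α′ q + 0        ≡⟨ cong (α′ q +_) (δ-≢ p≢q) ⟨
  α′ q + δ p q    ≡⟨ shift .at q ⟩
  α q + δ q q     ≡⟨ cong (α q +_) (δ-refl q) ⟩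
  α q + 1         ≡⟨ +-comm (α q) 1 ⟩
  suc (α q)       ∎
  where open ≡-Reasoning

-- The exchange property from transfers and simultaneous maxima.

Transferable : ((Fin k → ℕ) → Set) → Set
Transferable J = ∀ {α} p q → J α → α q < α p → ∃[ α′ ] (Shift p q α α′ × J α′)

-- Sorts the colours by α, with i below the other colours b such that α b ≡ α i.
sortingPriority : (Fin k → ℕ) → Fin k → Fin k → ℕ
sortingPriority α i b = 2 * α b + 𝟙 (¬? (i Fin.≟ b))

-- The tie-breaking summand is at most 1, so it cannot outweigh the 2 contributed by a unit of `α`.
priority-≤⇒≤ : (α : Fin k → ℕ) (i p q : Fin k) →
               sortingPriority α i q ≤ sortingPriority α i p → α q ≤ α p
priority-≤⇒≤ α i p q σq≤σp = ≮⇒≥ (λ αp<αq → <⇒≱ (begin-strict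
  2 * α p + 𝟙 (¬? (i Fin.≟ p))  ≤⟨ +-monoʳ-≤ (2 * α p) (𝟙-≤1 (¬? (i Fin.≟ p))) ⟩
  2 * α p + 1                   <⟨ +-monoʳ-< (2 * α p) (n<1+n 1) ⟩
  2 * α p + 2                   ≡⟨ +-comm (2 * α p) 2 ⟩
  2 + 2 * α p                   ≡⟨ *-suc 2 (α p) ⟨
  2 * suc (α p)                 ≤⟨ *-monoʳ-≤ 2 αp<αq ⟩
  2 * α q                       ≤⟨ m≤m+n (2 * α q) _ ⟩
  2 * α q + 𝟙 (¬? (i Fin.≟ q))  ∎) σq≤σp)
  where open ≤-Reasoning

-- The tie-breaking summand is 0 at `i` and 1 at `q`, so a tie in `α` would put `q` strictly above
-- `i`.
priority-≤⇒< : (α : Fin k → ℕ) {i q : Fin k} → i ≢ q →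
               sortingPriority α i q ≤ sortingPriority α i i → α q < α i
priority-≤⇒< α {i} {q} i≢q σq≤σi = *-cancelˡ-< 2 (α q) (α i) (begin-strict
  2 * α q                       <⟨ m<m+n (2 * α q) (s≤s z≤n) ⟩
  2 * α q + 1                   ≡⟨ cong (2 * α q +_) (𝟙-yes (¬? (i Fin.≟ q)) i≢q) ⟨
  2 * α q + 𝟙 (¬? (i Fin.≟ q))  ≤⟨ σq≤σi ⟩
  2 * α i + 𝟙 (¬? (i Fin.≟ i))  ≡⟨ cong (2 * α i +_) (𝟙-no (¬? (i Fin.≟ i)) (_$ refl)) ⟩
  2 * α i + 0                   ≡⟨ +-identityʳ (2 * α i) ⟩
  2 * α i                       ∎)
  where open ≤-Reasoning

module _ (J : (Fin k → ℕ) → Set)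
         (J-resp : ∀ {α α′} → α ≗ α′ → J α → J α′)
         (J-transfer : Transferable J) where

  -- Muirhead's argument: transfers from a surplus p to a deficit q keep λ′
  -- above γ on all upper level sets and bring it closer to γ.
  dominated : (σ γ : Fin k → ℕ) → (∀ p q → σ q ≤ σ p → γ q ≤ suc (γ p)) →
              ∀ {λ′} → J λ′ → sum γ ≡ sum λ′ →
              (∀ m → ⟨ above σ m , γ ⟩ ≤ ⟨ above σ m , λ′ ⟩) → J γ
  dominated σ γ nearlySorted {λ₀} = go (<-wellFounded (sum (λ b → γ b ∸ λ₀ b)))
    where
    go : ∀ {λ′} → Acc _<_ (sum (λ b → γ b ∸ λ′ b)) → J λ′ → sum γ ≡ sum λ′ →
         (∀ m → ⟨ above σ m , γ ⟩ ≤ ⟨ above σ m , λ′ ⟩) → J γ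
    go {λ′} (acc rs) Jλ total dom with Fin.any? (λ q → λ′ q <? γ q)
    -- No deficit is left, so `γ ≤ λ′` everywhere, and equal totals force equality.
    ... | no ∄ = J-resp (λ b → ≤-antisym (≮⇒≥ (λ λb<γb → <⇒≢ (sum-mono-< γ λ′ γ≤λ b λb<γb) total)) (γ≤λ b)) Jλ
      where
      γ≤λ : ∀ b → γ b ≤ λ′ b
      γ≤λ b = ≮⇒≥ (λ λb<γb → ∄ (b , λb<γb))
    ... | yes (q , λq<γq) with surplus σ (σ q) (dom (σ q)) q ≤-refl λq<γq
    ...   | p , σq≤σp , γp<λp , tight
      -- The transfer is allowed because `λ′ q < γ q ≤ suc (γ p) ≤ λ′ p`; the middle inequality is
      -- what `nearlySorted` is for.
      with J-transfer p q Jλ (<-≤-trans λq<γq (≤-trans (nearlySorted p q σq≤σp) γp<λp))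
    ...     | λ″ , shift , Jλ″ = go (rs decrease) Jλ″ total″ dom″
      where
      p≢q : p ≢ q
      p≢q refl = <-asym λq<γq γp<λp

      total″ : sum γ ≡ sum λ″
      total″ = trans total (sym (sum-Shift shift))

      -- The deficit at `q` drops by one. At `p` it stays 0, since `γ p < λ′ p` leaves a unit to
      -- give away.
      decrease : sum (λ b → γ b ∸ λ″ b) < sum (λ b → γ b ∸ λ′ b)
      decrease = sum-mono-< _ _ pointwise q
        (subst (λ l → γ q ∸ l < γ q ∸ λ′ q) (sym (Shift-q shift p≢q)) (∸-monoʳ-< ≤-refl λq<γq))
        where
        pointwise : ∀ b → γ b ∸ λ″ b ≤ γ b ∸ λ′ b
        pointwise b with p Fin.≟ b
        ... | no p≢b   = ∸-monoʳ-≤ (γ b) (Shift-≢p shift p≢b)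
        ... | yes refl = ≤-trans (≤-reflexive (m≤n⇒m∸n≡0 γp≤λ″p)) z≤n
          where
          γp≤λ″p : γ p ≤ λ″ p
          γp≤λ″p = s≤s⁻¹ (subst (γ p <_) (sym (Shift-p shift p≢q)) γp<λp)

      dom″ : ∀ m → ⟨ above σ m , γ ⟩ ≤ ⟨ above σ m , λ″ ⟩
      dom″ m with 𝟙-cases (m ≤? σ p) | 𝟙-cases (m ≤? σ q) | ⟨,⟩-Shift (above σ m) shift
      -- Only a level set with `p` but without `q` loses a unit, and there `tight` provides the
      -- slack.
      ... | inj₁ (m≤σp , eqp) | inj₂ (m≰σq , eqq) | eq rewrite eqp | eqq =
        s≤s⁻¹ (≤-trans (tight m (≰⇒> m≰σq) m≤σp)
          (≤-reflexive (trans (sym (+-identityʳ _)) (trans (sym eq) (+-comm _ 1)))))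
      ... | inj₁ (m≤σp , eqp) | inj₁ (m≤σq , eqq) | eq rewrite eqp | eqq =
        ≤-trans (dom m) (≤-reflexive (sym (+-cancelʳ-≡ 1 _ _ eq)))
      ... | inj₂ (m≰σp , eqp) | _ | eq rewrite eqp =
        ≤-trans (dom m) (≤-trans (m≤m+n _ _) (≤-reflexive (trans (sym eq) (+-identityʳ _))))

  -- The abstract form of M-convexity: `dominated` is applied with `γ` the exchanged exponent and
  -- `λ′` the simultaneous maximum for `sortingPriority α i`.
  exchange : (∀ {α β} → J α → J β → sum α ≡ sum β) →
             (∀ σ {α} → J α →
               ∃[ λ′ ] (J λ′ × (∀ m {β} → J β → ⟨ above σ m , β ⟩ ≤ ⟨ above σ m , λ′ ⟩))) →
             ∀ {α β} → J α → J β → ∀ i → β i < α i →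
             ∃[ j ] (α j < β j × (∀ {γ} → Shift i j α γ → J γ))
  exchange J-total J-max {α} {β} Jα Jβ i βi<αi
    -- Level 0 contains every colour, so `surplus`, with `α` and `β` in the roles of `γ` and `λ′`,
    -- needs only equal totals. It returns a colour `j` of lowest priority among those with
    -- `α j < β j`.
    with J-max (sortingPriority α i) Jα
       | surplus (sortingPriority α i) 0 (≤-reflexive ⟨1,α⟩≡⟨1,β⟩) i z≤n βi<αi
    where
    ⟨1,α⟩≡⟨1,β⟩ : ⟨ (λ _ → 1) , α ⟩ ≡ ⟨ (λ _ → 1) , β ⟩
    ⟨1,α⟩≡⟨1,β⟩ = trans (⟨1,⟩ α) (trans (J-total Jα Jβ) (sym (⟨1,⟩ β)))
  ... | λ′ , Jλ , max | j , _ , αj<βj , tight = j , αj<βj , γ∈J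
    where
    σ : Fin k → ℕ
    σ = sortingPriority α i

    i≢j : i ≢ j
    i≢j refl = <-asym αj<βj βi<αi

    γ∈J : ∀ {γ} → Shift i j α γ → J γ
    γ∈J {γ} shift = dominated σ γ nearlySorted Jλ (trans (sum-Shift shift) (J-total Jα Jλ)) dom
      where
      -- `α` is sorted by `σ`. The shift costs at most one unit except for `p = i` and `q = j`,
      -- where it costs two; there the tie-break gives the strict `α j < α i`.
      nearlySorted : ∀ p q → σ q ≤ σ p → γ q ≤ suc (γ p)
      nearlySorted p q σq≤σp = go (i Fin.≟ p) (j Fin.≟ q)
        where
        αq≤αp : α q ≤ α p
        αq≤αp = priority-≤⇒≤ α i p q σq≤σp

        go : Dec (i ≡ p) → Dec (j ≡ q) → γ q ≤ suc (γ p)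
        go (no i≢p)   _          = ≤-trans (Shift-≤suc shift q) (s≤s (≤-trans αq≤αp (Shift-≢p shift i≢p)))
        go (yes refl) (no j≢q)   = ≤-trans (Shift-≢q shift j≢q)
          (≤-trans αq≤αp (≤-reflexive (sym (Shift-p shift i≢j))))
        go (yes refl) (yes refl) = subst₂ _≤_ (sym (Shift-q shift i≢j)) (sym (Shift-p shift i≢j))
          (priority-≤⇒< α i≢j σq≤σp)

      dom : ∀ m → ⟨ above σ m , γ ⟩ ≤ ⟨ above σ m , λ′ ⟩
      dom m with 𝟙-cases (m ≤? σ j) | 𝟙-cases (m ≤? σ i) | ⟨,⟩-Shift (above σ m) shift
      -- The count of `γ` exceeds that of `α` only if the level set contains `j` but not `i`; then
      -- the strict inequality between `α` and `β` absorbs the unit. Otherwise the maximum over `α`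
      -- suffices.
      ... | inj₁ (m≤σj , eqj) | inj₂ (m≰σi , eqi) | eq rewrite eqi | eqj =
        ≤-trans (≤-reflexive (trans (sym (+-identityʳ _)) (trans eq (+-comm _ 1))))
                (≤-trans (tight m (≰⇒> m≰σi) m≤σj) (max m Jβ))
      ... | inj₁ (_ , eqj) | inj₁ (_ , eqi) | eq rewrite eqi | eqj =
        ≤-trans (≤-reflexive (+-cancelʳ-≡ 1 _ _ eq)) (max m Jα)
      ... | inj₂ (_ , eqj) | _ | eq rewrite eqj =
        ≤-trans (m≤m+n _ _) (≤-trans (≤-reflexive (trans eq (+-identityʳ _))) (max m Jα))

-- Transpositions of colours.

transpose-left : (p q : Fin k) → transpose p q p ≡ q
transpose-left p q rewrite dec-true (p Fin.≟ p) refl = refl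

transpose-right : (p q : Fin k) → transpose p q q ≡ p
transpose-right p q with q Fin.≟ p
... | yes q≡p = q≡p
... | no  _   rewrite dec-true (q Fin.≟ q) refl = refl

transpose-other : {p q b : Fin k} → b ≢ p → b ≢ q → transpose p q b ≡ b
transpose-other {p = p} {q} {b} b≢p b≢q
  rewrite dec-false (b Fin.≟ p) b≢p | dec-false (b Fin.≟ q) b≢q = refl

transpose-involutive : (p q b : Fin k) → transpose p q (transpose p q b) ≡ b
transpose-involutive p q b = go (b Fin.≟ p) (b Fin.≟ q)
  where
  go : Dec (b ≡ p) → Dec (b ≡ q) → transpose p q (transpose p q b) ≡ b
  go (yes refl) _          = trans (cong (transpose p q) (transpose-left p q)) (transpose-right p q)
  go (no _)     (yes refl) = trans (cong (transpose p q) (transpose-right p q)) (transpose-left p q)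
  go (no b≢p)   (no b≢q)   = trans (cong (transpose p q) other) other
    where other = transpose-other b≢p b≢q

δ-transpose : (p q x b : Fin k) → δ (transpose p q x) b ≡ δ x (transpose p q b)
δ-transpose p q x b = 𝟙-⇔ (transpose p q x Fin.≟ b) (x Fin.≟ transpose p q b)
  (λ { refl → sym (transpose-involutive p q x) }) (λ { refl → transpose-involutive p q b })

-- Sums and colour counts on initial segments of the vertices.

∑< : ℕ → (ℕ → ℕ) → ℕ
∑< zero    f = 0
∑< (suc n) f = ∑< n f + f n

∑<-cong : ∀ n {f g : ℕ → ℕ} → (∀ {u} → u < n → f u ≡ g u) → ∑< n f ≡ ∑< n g
∑<-cong zero    f≡g = refl
∑<-cong (suc n) f≡g = cong₂ _+_ (∑<-cong n (f≡g ∘ m≤n⇒m≤1+n)) (f≡g ≤-refl)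

∑<-+ : ∀ m l (f : ℕ → ℕ) → ∑< (m + l) f ≡ ∑< m f + ∑< l (λ u → f (m + u))
∑<-+ m zero    f rewrite +-identityʳ m = sym (+-identityʳ _)
∑<-+ m (suc l) f rewrite +-suc m l | ∑<-+ m l f = +-assoc (∑< m f) _ _

-- Colourings are functions on all of ℕ read only below `n`, so that cutting and shifting segments
-- needs no casts between `Fin` types.
content : ℕ → (ℕ → Fin k) → Fin k → ℕ
content n c b = ∑< n (λ u → δ (c u) b)

-- Double counting over vertices and colours; the passage between level counts of a colouring and
-- pairings with its exponent.
∑<-content : ∀ n (c : ℕ → Fin k) (s : Fin k → ℕ) → ∑< n (s ∘ c) ≡ ⟨ s , content n c ⟩
∑<-content zero    c s = sym (⟨,⟩-0 s)
∑<-content (suc n) c s = begin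
  ∑< n (s ∘ c) + s (c n)                    ≡⟨ cong₂ _+_ (∑<-content n c s) (sym (⟨,⟩-δ s (c n))) ⟩
  ⟨ s , content n c ⟩ + ⟨ s , δ (c n) ⟩     ≡⟨ ⟨,⟩-+ s (content n c) (δ (c n)) ⟨
  ⟨ s , content (suc n) c ⟩                 ∎
  where open ≡-Reasoning

content-≥1 : ∀ n (c : ℕ → Fin k) {x} → x < n → 1 ≤ content n c (c x)
content-≥1 (suc n) c {x} x<1+n with m<1+n⇒m<n∨m≡n x<1+n
... | inj₁ x<n  = ≤-trans (content-≥1 n c x<n) (m≤m+n _ _)
... | inj₂ refl rewrite δ-refl (c x) = m≤n+m 1 _

content-≡0 : ∀ n (c : ℕ → Fin k) b → (∀ {u} → u < n → c u ≢ b) → content n c b ≡ 0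
content-≡0 zero    c b c≢b = refl
content-≡0 (suc n) c b c≢b = cong₂ _+_ (content-≡0 n c b (c≢b ∘ m≤n⇒m≤1+n)) (δ-≢ (c≢b ≤-refl))

content-≤1 : ∀ n (c : ℕ → Fin k) b → (∀ {u v} → u < v → v < n → c u ≢ c v) → content n c b ≤ 1
content-≤1 zero    c b inj = z≤n
content-≤1 (suc n) c b inj with c n Fin.≟ b
... | yes refl rewrite content-≡0 n c (c n) (λ u<n → inj u<n ≤-refl) = ≤-refl
... | no  _    rewrite +-identityʳ (content n c b) =
  content-≤1 n c b (λ u<v v<n → inj u<v (m≤n⇒m≤1+n v<n))

splice : {A : Set} → ℕ → (ℕ → A) → (ℕ → A) → ℕ → A
splice w c d u = if does (u <? w) then c u else d u

splice-< : {A : Set} {w : ℕ} (c d : ℕ → A) {u : ℕ} → u < w → splice w c d u ≡ c u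
splice-< {w = w} _ _ {u} u<w rewrite dec-true (u <? w) u<w = refl

splice-≥ : {A : Set} {w : ℕ} (c d : ℕ → A) {u : ℕ} → w ≤ u → splice w c d u ≡ d u
splice-≥ {w = w} _ _ {u} w≤u rewrite dec-false (u <? w) (≤⇒≯ w≤u) = refl

-- Proper colourings of interval graphs.

module Interval (H : ℕ → ℕ) (H-mono : ∀ {u v} → u ≤ v → H u ≤ H v) where

  -- The vertices u < v are adjacent iff v < H u.
  Proper< : ℕ → (ℕ → Fin k) → Set
  Proper< n c = ∀ {u v} → u < v → v < n → v < H u → c u ≢ c v

  Proper<-≤ : ∀ {m n} {c : ℕ → Fin k} → m ≤ n → Proper< n c → Proper< m c
  Proper<-≤ m≤n prop u<v v<m = prop u<v (<-≤-trans v<m m≤n)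

  -- Transfer of one unit by swapping two colours on an initial segment.

  module _ {n : ℕ} {c : ℕ → Fin k} (prop : Proper< n c) {p q : Fin k} (p≢q : p ≢ q) where

    -- Swapping p and q on the vertices before w keeps the colouring proper.
    SafeCut : ℕ → Set
    SafeCut w = ∀ {u v} → u < w → w ≤ v → v < n → v < H u → transpose p q (c u) ≢ c v

    LastIs-p : ℕ → Set
    LastIs-p v = ∃[ x ] (x < v × c x ≡ p × (∀ {u} → x < u → u < v → c u ≢ q))

    -- The invariant of `scan`. The lead of `p` over `q` becomes one only at a vertex coloured `p`,
    -- and a later `q` would cancel it; hence `LastIs-p`.
    Excess≤1 : ℕ → Set
    Excess≤1 v = content v c p ≤ content v c q ⊎
                 (content v c p ≡ suc (content v c q) × LastIs-p v)

    -- With a lead of exactly one before `w`, swapping there moves exactly one unit from `p` to `q`.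
    BalancingCut : Set
    BalancingCut = ∃[ w ] (w ≤ n × content w c p ≡ suc (content w c q) × SafeCut w)

    -- The last vertex x before w coloured p or q has colour p, so an edge across w
    -- between these colours would join a p-coloured vertex to w or to x.
    safe-cut : ∀ {w} → c w ≡ p → w < n → LastIs-p w → SafeCut w
    safe-cut {w} cw≡p w<n (x , x<w , cx≡p , no-q) {u} {v} u<w w≤v v<n v<Hu τcu≡cv =
      go (c u Fin.≟ p) (c u Fin.≟ q) (<-cmp u x)
      where
      go : Dec (c u ≡ p) → Dec (c u ≡ q) → Tri (u < x) (u ≡ x) (x < u) → ⊥
      go (yes cu≡p) _ _ = prop u<w w<n (≤-<-trans w≤v v<Hu) (trans cu≡p (sym cw≡p))
      go (no cu≢p) (no cu≢q) _ =
        prop (<-≤-trans u<w w≤v) v<n v<Hu (trans (sym (transpose-other cu≢p cu≢q)) τcu≡cv)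
      go (no cu≢p) (yes cu≡q) (tri≈ _ refl _) = cu≢p cx≡p
      go (no cu≢p) (yes cu≡q) (tri> _ _ x<u)  = no-q x<u u<w cu≡q
      go (no cu≢p) (yes cu≡q) (tri< u<x _ _)  =
        prop (<-≤-trans x<w w≤v) v<n (<-≤-trans v<Hu (H-mono (<⇒≤ u<x))) (begin
          c x                    ≡⟨ cx≡p ⟩
          p                      ≡⟨ transpose-right p q ⟨
          transpose p q q        ≡⟨ cong (transpose p q) cu≡q ⟨
          transpose p q (c u)    ≡⟨ τcu≡cv ⟩
          c v                    ∎)
        where open ≡-Reasoning

    scan : ∀ v → v ≤ n → BalancingCut ⊎ Excess≤1 v
    scan zero    _   = inj₂ (inj₁ z≤n)
    scan (suc v) v<n with scan v (<⇒≤ v<n)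
    ... | inj₁ found = inj₁ found
    ... | inj₂ excess with c v Fin.≟ p | c v Fin.≟ q | excess
    ...   | yes cv≡p | yes cv≡q | _ = contradiction (trans (sym cv≡p) cv≡q) p≢q
    -- The lead is about to become two: the cut is placed just before this second `p`, as `safe-cut`
    -- requires.
    ...   | yes cv≡p | no _ | inj₂ (e , last) = inj₁ (v , <⇒≤ v<n , e , safe-cut cv≡p v<n last)
    ...   | yes cv≡p | no _ | inj₁ le with m≤n⇒m<n∨m≡n le
    ...     | inj₁ lt = inj₂ (inj₁ (subst₂ _≤_ (+-comm 1 _) (sym (+-identityʳ _)) lt))
    ...     | inj₂ e  = inj₂ (inj₂ (trans (+-comm _ 1) (cong suc (trans e (sym (+-identityʳ _)))) ,
                          v , ≤-refl , cv≡p , λ v<u u<1+v → contradiction (s≤s⁻¹ u<1+v) (<⇒≱ v<u)))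
    scan (suc v) v<n | inj₂ excess | no _ | yes cv≡q | inj₁ le =
      inj₂ (inj₁ (≤-trans (≤-reflexive (+-identityʳ _)) (≤-trans le (m≤m+n _ _))))
    scan (suc v) v<n | inj₂ excess | no _ | yes cv≡q | inj₂ (e , _) =
      inj₂ (inj₁ (≤-reflexive (trans (+-identityʳ _) (trans e (+-comm 1 _)))))
    scan (suc v) v<n | inj₂ excess | no _ | no _ | inj₁ le =
      inj₂ (inj₁ (+-monoˡ-≤ 0 le))
    scan (suc v) v<n | inj₂ excess | no _ | no cv≢q | inj₂ (e , x , x<v , cx≡p , no-q) =
      inj₂ (inj₂ (cong (_+ 0) e , x , m≤n⇒m≤1+n x<v , cx≡p , no-q′))
      where
      no-q′ : ∀ {u} → x < u → u < suc v → c u ≢ q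
      no-q′ x<u u<1+v with m<1+n⇒m<n∨m≡n u<1+v
      ... | inj₁ u<v  = no-q x<u u<v
      ... | inj₂ refl = cv≢q

    balancingCut : content n c q < content n c p → BalancingCut
    balancingCut q<p with scan n ≤-refl
    ... | inj₁ found          = found
    ... | inj₂ (inj₁ p≤q)     = contradiction p≤q (<⇒≱ q<p)
    -- The lead is one at the end: the swap is made on all vertices, and no edge crosses the cut.
    ... | inj₂ (inj₂ (e , _)) = n , ≤-refl , e , λ _ n≤v v<n → contradiction n≤v (<⇒≱ v<n)

    swapBefore : ℕ → ℕ → Fin k
    swapBefore w = splice w (transpose p q ∘ c) c

    swapBefore-< : ∀ {w u} → u < w → swapBefore w u ≡ transpose p q (c u)
    swapBefore-< = splice-< (transpose p q ∘ c) c

    swapBefore-≥ : ∀ {w u} → w ≤ u → swapBefore w u ≡ c u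
    swapBefore-≥ = splice-≥ (transpose p q ∘ c) c

    swapBefore-proper : ∀ {w} → SafeCut w → Proper< n (swapBefore w)
    swapBefore-proper {w} safe {u} {v} u<v v<n v<Hu eq with v <? w | u <? w
    ... | yes v<w | _ = prop u<v v<n v<Hu (begin
      c u                                  ≡⟨ transpose-involutive p q (c u) ⟨
      transpose p q (transpose p q (c u))  ≡⟨ cong (transpose p q) (swapBefore-< (<-trans u<v v<w)) ⟨
      transpose p q (swapBefore w u)       ≡⟨ cong (transpose p q) eq ⟩
      transpose p q (swapBefore w v)       ≡⟨ cong (transpose p q) (swapBefore-< v<w) ⟩
      transpose p q (transpose p q (c v))  ≡⟨ transpose-involutive p q (c v) ⟩
      c v                                  ∎)
      where open ≡-Reasoning
    ... | no v≮w | yes u<w = safe u<w (≮⇒≥ v≮w) v<n v<Hu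
      (trans (sym (swapBefore-< u<w)) (trans eq (swapBefore-≥ (≮⇒≥ v≮w))))
    ... | no v≮w | no u≮w = prop u<v v<n v<Hu
      (trans (sym (swapBefore-≥ (≮⇒≥ u≮w))) (trans eq (swapBefore-≥ (≮⇒≥ v≮w))))

    -- From `w` on nothing changes; before `w` the counts of `p` and `q`, which differ by one, trade
    -- places.
    swapBefore-shift : ∀ {w} → w ≤ n → content w c p ≡ suc (content w c q) →
                       Shift p q (content n c) (content n (swapBefore w))
    swapBefore-shift {w} w≤n excess with m≤n⇒∃[o]m+o≡n w≤n
    ... | l , refl = shifting λ b → begin
      content (w + l) (swapBefore w) b + δ p b        ≡⟨ cong (_+ δ p b) (∑<-+ w l _) ⟩
      content w (swapBefore w) b + tail (swapBefore w) b + δ p b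
                                                      ≡⟨ cong₂ (λ x y → x + y + δ p b) (head-swap b) (tail-swap b) ⟩
      content w c (transpose p q b) + tail c b + δ p b ≡⟨ exchange-+ _ (tail c b) (δ p b) ⟩
      content w c (transpose p q b) + δ p b + tail c b ≡⟨ cong (_+ tail c b) (head-shift b) ⟩
      content w c b + δ q b + tail c b                ≡⟨ exchange-+ _ (δ q b) (tail c b) ⟩
      content w c b + tail c b + δ q b                ≡⟨ cong (_+ δ q b) (∑<-+ w l _) ⟨
      content (w + l) c b + δ q b                     ∎
      where
      open ≡-Reasoning
      tail : (ℕ → Fin k) → Fin k → ℕ
      tail c b = ∑< l (λ u → δ (c (w + u)) b)

      exchange-+ : ∀ x y z → x + y + z ≡ x + z + y
      exchange-+ x y z = trans (+-assoc x y z) (trans (cong (x +_) (+-comm y z)) (sym (+-assoc x z y)))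

      tail-swap : ∀ b → tail (swapBefore w) b ≡ tail c b
      tail-swap b = ∑<-cong l (λ {u} _ → cong (λ x → δ x b) (swapBefore-≥ (m≤m+n w u)))

      head-swap : ∀ b → content w (swapBefore w) b ≡ content w c (transpose p q b)
      head-swap b = ∑<-cong w (λ {u} u<w → trans (cong (λ x → δ x b) (swapBefore-< u<w)) (δ-transpose p q (c u) b))

      head-shift : ∀ b → content w c (transpose p q b) + δ p b ≡ content w c b + δ q b
      head-shift b with p Fin.≟ b | q Fin.≟ b
      ... | yes refl | yes refl = contradiction refl p≢q
      ... | yes refl | no _ = trans (cong (λ x → content w c x + 1) (transpose-left p q))
        (trans (+-comm _ 1) (trans (sym excess) (sym (+-identityʳ _))))
      ... | no _ | yes refl = trans (cong (λ x → content w c x + 0) (transpose-right p q))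
        (trans (+-identityʳ _) (trans excess (+-comm 1 _)))
      ... | no p≢b | no q≢b = cong (λ x → content w c x + 0) (transpose-other (p≢b ∘ sym) (q≢b ∘ sym))

  Realizable : ℕ → (Fin k → ℕ) → Set
  Realizable n α = ∃[ c ] (Proper< n c × content n c ≗ α)

  Realizable-resp : ∀ {n} {α α′ : Fin k → ℕ} → α ≗ α′ → Realizable n α → Realizable n α′
  Realizable-resp α≗α′ (c , prop , eq) = c , prop , λ b → trans (eq b) (α≗α′ b)

  Realizable-transferable : ∀ {n} → Transferable {k} (Realizable n)
  Realizable-transferable {n = n} p q (c , prop , eq) αq<αp
    with balancingCut prop {p} {q} (λ { refl → <-irrefl refl αq<αp }) (subst₂ _<_ (sym (eq q)) (sym (eq p)) αq<αp)
  ... | w , w≤n , excess , safe =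
    content n (swapBefore prop p≢q w)
      , shifting (λ b → trans (swapBefore-shift prop p≢q w≤n excess .Shift.at b) (cong (_+ δ q b) (eq b)))
      , swapBefore prop p≢q w , swapBefore-proper prop p≢q safe , λ _ → refl
    where
    p≢q : p ≢ q
    p≢q refl = <-irrefl refl αq<αp

  Realizable-total : ∀ {n} {α : Fin k → ℕ} → Realizable n α → sum α ≡ ∑< n (λ _ → 1)
  Realizable-total {n = n} {α} (c , _ , eq) = begin
    sum α                          ≡⟨ sum-cong-≗ eq ⟨
    sum (content n c)              ≡⟨ ⟨1,⟩ (content n c) ⟨
    ⟨ (λ _ → 1) , content n c ⟩    ≡⟨ ∑<-content n c (λ _ → 1) ⟨
    ∑< n (λ _ → 1)                 ∎
    where open ≡-Reasoning

  -- First-fit colourings and their maximality.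

  Blocked : (ℕ → Fin k) → ℕ → Fin k → Set
  Blocked c v b = ∃[ x ] (x < v × (v < H x × c x ≡ b))

  blocked? : (c : ℕ → Fin k) (v : ℕ) → Decidable (Blocked c v)
  blocked? c v b = anyUpTo? (λ x → (v <? H x) ×-dec (c x Fin.≟ b)) v

  -- Walks down from `v` to the first non-neighbour; monotonicity of `H` excludes everything below
  -- it. So the earlier neighbours of `v` form an interval ending at `v - 1`, returned as a start
  -- `l` and a length `o`.
  leastNeighbour : ∀ v → ∃[ l ] ∃[ o ] (l + o ≡ v ×
                     (∀ {u} → u < l → ¬ v < H u) × (∀ {u} → l ≤ u → u < v → v < H u))
  leastNeighbour v = go v 0 (+-identityʳ v) (λ v≤u u<v → contradiction v≤u (<⇒≱ u<v))
    where
    go : ∀ t o → t + o ≡ v → (∀ {u} → t ≤ u → u < v → v < H u) →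
         ∃[ l ] ∃[ o ] (l + o ≡ v ×
           (∀ {u} → u < l → ¬ v < H u) × (∀ {u} → l ≤ u → u < v → v < H u))
    go zero    o eq adj = 0 , o , eq , (λ ()) , adj
    go (suc t) o eq adj with v <? H t
    ... | no v≮Ht = suc t , o , eq , (λ u<1+t v<Hu → v≮Ht (<-≤-trans v<Hu (H-mono (s≤s⁻¹ u<1+t)))) , adj
    ... | yes v<Ht = go t (suc o) (trans (+-suc t o) eq) adj′
      where
      adj′ : ∀ {u} → t ≤ u → u < v → v < H u
      adj′ t≤u u<v with m≤n⇒m<n∨m≡n t≤u
      ... | inj₁ t<u  = adj t<u u<v
      ... | inj₂ refl = v<Ht

  module _ (σ : Fin k → ℕ) where

    -- The neighbours of v below v are l, …, v - 1 and form a clique with v: f repeats no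
    -- colour on l, …, v, while c uses every blocked colour on l, …, v - 1.
    blockedClique : ∀ {v} (f c : ℕ → Fin k) m → Proper< (suc v) f →
      (∀ b → m ≤ σ b → Blocked c v b) →
      ∃[ l ] ∃[ o ] (l + o ≡ v ×
        ∑< (suc o) (λ u → above σ m (f (l + u))) ≤ ∑< o (λ u → above σ m (c (l + u))))
    blockedClique {v} f c m prop blocked with leastNeighbour v
    ... | l , o , refl , far , near = l , o , refl , (begin
      ∑< (suc o) (above σ m ∘ f ∘ (l +_))            ≡⟨ ∑<-content (suc o) (f ∘ (l +_)) (above σ m) ⟩
      ⟨ above σ m , content (suc o) (f ∘ (l +_)) ⟩   ≤⟨ sum-mono-≤ _ _ pointwise ⟩
      ⟨ above σ m , content o (c ∘ (l +_)) ⟩         ≡⟨ ∑<-content o (c ∘ (l +_)) (above σ m) ⟨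
      ∑< o (above σ m ∘ c ∘ (l +_))                  ∎)
      where
      open ≤-Reasoning
      f-clique : ∀ {x y} → x < y → y < suc o → f (l + x) ≢ f (l + y)
      f-clique {x} {y} x<y y<1+o = prop (+-monoʳ-< l x<y)
        (s≤s (+-monoʳ-≤ l (s≤s⁻¹ y<1+o)))
        (≤-<-trans (+-monoʳ-≤ l (s≤s⁻¹ y<1+o)) (near (m≤m+n l x) (+-monoʳ-< l (<-≤-trans x<y (s≤s⁻¹ y<1+o)))))

      c-meets : ∀ {b} → Blocked c (l + o) b → 1 ≤ content o (c ∘ (l +_)) b
      c-meets (x , x<v , v<Hx , refl) with x <? l
      ... | yes x<l = contradiction v<Hx (far x<l)
      ... | no x≮l with m≤n⇒∃[o]m+o≡n (≮⇒≥ x≮l)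
      ...   | y , refl = content-≥1 o (c ∘ (l +_)) (+-cancelˡ-< l y o x<v)

      pointwise : ∀ b → above σ m b * content (suc o) (f ∘ (l +_)) b ≤ above σ m b * content o (c ∘ (l +_)) b
      pointwise b with 𝟙-cases (m ≤? σ b)
      ... | inj₁ (m≤σb , eq) rewrite eq =
        *-monoʳ-≤ 1 (≤-trans (content-≤1 (suc o) (f ∘ (l +_)) b f-clique) (c-meets (blocked b m≤σb)))
      ... | inj₂ (_ , eq)    rewrite eq = z≤n

    -- The first-fit condition for the priority `σ`, with ties left open and properness kept
    -- separate.
    Greedy : ℕ → (ℕ → Fin k) → Set
    Greedy n c = ∀ {v} → v < n → ∀ b → σ (c v) < σ b → Blocked c v b

    -- Strong induction on the number of vertices. Where `c` uses a top colour, `f` gains no more.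
    -- Elsewhere `blockedClique` settles the vertices `l`, ..., `v` at once and the induction
    -- resumes at `l`. As `c` is independent of `m`, all level counts are maximal simultaneously.
    greedy-max : ∀ {n} {f c : ℕ → Fin k} → Proper< n f → Greedy n c → ∀ m →
                 ∑< n (above σ m ∘ f) ≤ ∑< n (above σ m ∘ c)
    greedy-max {n} {f} {c} prop greedy m = go n (<-wellFounded n) ≤-refl
      where
      go : ∀ v → Acc _<_ v → v ≤ n → ∑< v (above σ m ∘ f) ≤ ∑< v (above σ m ∘ c)
      go zero    _        _   = z≤n
      go (suc v) (acc rs) v<n with 𝟙-cases (m ≤? σ (c v))
      ... | inj₁ (_ , eq) = +-mono-≤ (go v (rs ≤-refl) (<⇒≤ v<n)) (≤-trans (𝟙-≤1 (m ≤? σ (f v))) (≤-reflexive (sym eq)))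
      ... | inj₂ (m≰σcv , _)
        with blockedClique f c m (Proper<-≤ v<n prop) (λ b m≤σb → greedy v<n b (<-≤-trans (≰⇒> m≰σcv) m≤σb))
      ...   | l , o , refl , clique = begin
        ∑< (suc (l + o)) (above σ m ∘ f)                             ≡⟨ cong (λ v → ∑< v (above σ m ∘ f)) (+-suc l o) ⟨
        ∑< (l + suc o) (above σ m ∘ f)                               ≡⟨ ∑<-+ l (suc o) (above σ m ∘ f) ⟩
        ∑< l (above σ m ∘ f) + ∑< (suc o) (above σ m ∘ f ∘ (l +_))
          ≤⟨ +-mono-≤ (go l (rs (s≤s (m≤m+n l o))) (≤-trans (m≤m+n l o) (<⇒≤ v<n))) clique ⟩
        ∑< l (above σ m ∘ c) + ∑< o (above σ m ∘ c ∘ (l +_))         ≡⟨ ∑<-+ l o (above σ m ∘ c) ⟨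
        ∑< (l + o) (above σ m ∘ c)                                   ≤⟨ m≤m+n _ _ ⟩
        ∑< (suc (l + o)) (above σ m ∘ c)                             ∎
        where open ≤-Reasoning

    -- First-fit never runs out of colours, because the proper colouring `f` shows that cliques are
    -- small enough.
    greedy-exists : ∀ {n} {f : ℕ → Fin k} → Proper< n f → ∀ v → v ≤ n →
                    ∃[ c ] (Proper< v c × Greedy v c)
    -- Any function would do here; `f` is at hand.
    greedy-exists {f = f} prop zero    _   = f , (λ _ ()) , (λ ())
    greedy-exists {f = f} prop (suc v) v<n with greedy-exists prop v (<⇒≤ v<n)
    ... | c , c-prop , greedy with Fin.any? (λ b → ¬? (blocked? c v b))
    -- At level 0 every vertex counts, so a fully blocked `v` would give `suc o ≤ o`.
    ...   | no ∄ with blockedClique f c 0 (Proper<-≤ v<n prop)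
                        (λ b _ → decidable-stable (blocked? c v b) (λ ¬bl → ∄ (b , ¬bl)))
    ...     | l , o , _ , clique = contradiction clique (<⇒≱ (m<m+n (∑< o (λ _ → 1)) (s≤s z≤n)))
    greedy-exists {f = f} prop (suc v) v<n | c , c-prop , greedy | yes (b₀ , free₀)
      with argmax σ (λ b → ¬? (blocked? c v b)) b₀ free₀
    ...     | b , free , b-max = c′ , c′-prop , c′-greedy
      where
      c′ : ℕ → Fin k
      c′ = splice v c (λ _ → b)

      old : ∀ {u} → u < v → c′ u ≡ c u
      old = splice-< c (λ _ → b)

      new : c′ v ≡ b
      new = splice-≥ c (λ _ → b) ≤-refl

      c′-prop : Proper< (suc v) c′
      c′-prop {x} {y} x<y y<1+v y<Hx c′x≡c′y with m<1+n⇒m<n∨m≡n y<1+v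
      ... | inj₁ y<v  = c-prop x<y y<v y<Hx (trans (sym (old (<-trans x<y y<v))) (trans c′x≡c′y (old y<v)))
      ... | inj₂ refl = free (x , x<y , y<Hx , trans (sym (old x<y)) (trans c′x≡c′y new))

      blocked-old : ∀ {u a} → u ≤ v → Blocked c u a → Blocked c′ u a
      blocked-old u≤v (x , x<u , u<Hx , cx≡a) = x , x<u , u<Hx , trans (old (<-≤-trans x<u u≤v)) cx≡a

      c′-greedy : Greedy (suc v) c′
      c′-greedy {u} u<1+v a σ< with m<1+n⇒m<n∨m≡n u<1+v
      ... | inj₁ u<v  = blocked-old (<⇒≤ u<v) (greedy u<v a (subst (λ x → σ x < σ a) (old u<v) σ<))
      ... | inj₂ refl = blocked-old ≤-refl (decidable-stable (blocked? c v a)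
                          (λ ¬bl → <⇒≱ (subst (λ x → σ x < σ a) new σ<) (b-max a ¬bl)))

    -- `α₀` supplies the proper colouring that `greedy-exists` starts from.
    Realizable-greedy : ∀ {n} {α₀ : Fin k → ℕ} → Realizable n α₀ →
      ∃[ λ′ ] (Realizable n λ′ × (∀ m {α} → Realizable n α → ⟨ above σ m , α ⟩ ≤ ⟨ above σ m , λ′ ⟩))
    Realizable-greedy {n} (f₀ , prop₀ , _) with greedy-exists prop₀ n ≤-refl
    ... | c , c-prop , greedy = content n c , (c , c-prop , λ _ → refl) , λ { m (f , prop , eq) → begin
      ⟨ above σ m , _ ⟩            ≡⟨ ⟨,⟩-congʳ (above σ m) eq ⟨
      ⟨ above σ m , content n f ⟩  ≡⟨ ∑<-content n f (above σ m) ⟨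
      ∑< n (above σ m ∘ f)         ≤⟨ greedy-max prop greedy m ⟩
      ∑< n (above σ m ∘ c)         ≡⟨ ∑<-content n c (above σ m) ⟩
      ⟨ above σ m , content n c ⟩  ∎ }
      where open ≤-Reasoning

-- Exponent vectors and the support of the chromatic polynomial.

lookup-injective : {α β : Vec ℕ n} → (∀ b → lookup α b ≡ lookup β b) → α ≡ β
lookup-injective {α = α} {β} eq =
  trans (sym (Vec.tabulate∘lookup α)) (trans (Vec.tabulate-cong eq) (Vec.tabulate∘lookup β))

lookup-e : (i b : Fin k) → lookup (e i) b ≡ δ i b
lookup-e {k} i b with i Fin.≟ b
... | yes refl = Vec.lookup∘updateAt i (replicate k 0)
... | no i≢b   = trans (Vec.lookup∘updateAt′ b i (i≢b ∘ sym) (replicate k 0)) (Vec.lookup-replicate b 0)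

-- Since `δ i` is at most `α` everywhere, the truncated subtraction is exact.
lookup-move : (α : Exponent k) (i j : Fin k) → 1 ≤ lookup α i →
              Shift i j (lookup α) (lookup ((α ⊖ e i) ⊕ e j))
lookup-move α i j 1≤αi = shifting λ b → begin
  lookup ((α ⊖ e i) ⊕ e j) b + δ i b                  ≡⟨ cong (_+ δ i b) (Vec.lookup-zipWith _+_ b (α ⊖ e i) (e j)) ⟩
  lookup (α ⊖ e i) b + lookup (e j) b + δ i b          ≡⟨ cong (λ z → z + lookup (e j) b + δ i b) (Vec.lookup-zipWith _∸_ b α (e i)) ⟩
  lookup α b ∸ lookup (e i) b + lookup (e j) b + δ i b ≡⟨ cong₂ (λ y z → lookup α b ∸ y + z + δ i b) (lookup-e i b) (lookup-e j b) ⟩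
  lookup α b ∸ δ i b + δ j b + δ i b                   ≡⟨ +-assoc (lookup α b ∸ δ i b) (δ j b) (δ i b) ⟩
  lookup α b ∸ δ i b + (δ j b + δ i b)                 ≡⟨ cong (λ z → lookup α b ∸ δ i b + z) (+-comm (δ j b) (δ i b)) ⟩
  lookup α b ∸ δ i b + (δ i b + δ j b)                 ≡⟨ +-assoc (lookup α b ∸ δ i b) (δ i b) (δ j b) ⟨
  lookup α b ∸ δ i b + δ i b + δ j b                   ≡⟨ cong (_+ δ j b) (m∸n+n≡m (δ≤α b)) ⟩
  lookup α b + δ j b                                   ∎
  where
  open ≡-Reasoning
  δ≤α : ∀ b → δ i b ≤ lookup α b
  δ≤α b with i Fin.≟ b
  ... | yes refl = 1≤αi
  ... | no _     = z≤n

-- Folded in the same way as `Πᴾ`, so that the product over the vertices becomes a single term with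
-- this exponent.
weight : Coloring n k → Exponent k
weight f = foldr _⊕_ (replicate _ 0) (List.map (λ v → e (lookup f v)) (allFin _))

Πᴾ-x : (is : List (Fin k)) →
       Πᴾ (List.map x is) ≡ [ (1ℤ , foldr _⊕_ (replicate _ 0) (List.map e is)) ]
Πᴾ-x []       = refl
Πᴾ-x (i ∷ is) rewrite Πᴾ-x is = refl

Πᴾ-weight : (f : Coloring n k) → Πᴾ (List.map (λ v → x (lookup f v)) (allFin n)) ≡ [ (1ℤ , weight f) ]
Πᴾ-weight {n} f = begin
  Πᴾ (List.map (λ v → x (lookup f v)) (allFin n))          ≡⟨ cong Πᴾ (List.map-∘ (allFin n)) ⟩
  Πᴾ (List.map x (List.map (lookup f) (allFin n)))         ≡⟨ Πᴾ-x (List.map (lookup f) (allFin n)) ⟩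
  [ (1ℤ , foldr _⊕_ (replicate _ 0) (List.map e (List.map (lookup f) (allFin n)))) ]
    ≡⟨ cong (λ es → [ (1ℤ , foldr _⊕_ (replicate _ 0) es) ]) (List.map-∘ (allFin n)) ⟨
  [ (1ℤ , weight f) ]                                      ∎
  where open ≡-Reasoning

lookup-foldr-⊕ : ∀ {m} (g : Fin m → Fin k) b →
  lookup (foldr _⊕_ (replicate _ 0) (List.tabulate (e ∘ g))) b ≡ sum (λ i → δ (g i) b)
lookup-foldr-⊕ {m = zero}  g b = Vec.lookup-replicate b 0
lookup-foldr-⊕ {m = suc m} g b = trans (Vec.lookup-zipWith _+_ b (e (g zero)) _)
  (cong₂ _+_ (lookup-e (g zero) b) (lookup-foldr-⊕ (g ∘ suc) b))

sum-toℕ : ∀ n (h : ℕ → ℕ) → sum {n} (h ∘ toℕ) ≡ ∑< n h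
sum-toℕ zero    h = refl
sum-toℕ (suc n) h = trans (cong (h 0 +_) (sum-toℕ n (h ∘ suc))) (sym (∑<-+ 1 n h))

-- The values of c from n on are irrelevant.
Represents : (ℕ → Fin k) → Coloring n k → Set
Represents c f = ∀ u → lookup f u ≡ c (toℕ u)

lookup-weight : (c : ℕ → Fin k) (f : Coloring n k) → Represents c f → lookup (weight f) ≗ content n c
lookup-weight {n = n} c f rep b = begin
  lookup (weight f) b
    ≡⟨ cong (λ es → lookup (foldr _⊕_ (replicate _ 0) es) b) (List.map-tabulate id (e ∘ lookup f)) ⟩
  lookup (foldr _⊕_ (replicate _ 0) (List.tabulate (e ∘ lookup f))) b
                                      ≡⟨ lookup-foldr-⊕ (lookup f) b ⟩
  sum (λ u → δ (lookup f u) b)        ≡⟨ sum-cong-≗ (λ u → cong (λ a → δ a b) (rep u)) ⟩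
  sum {n} (λ u → δ (c (toℕ u)) b)     ≡⟨ sum-toℕ n (λ u → δ (c u) b) ⟩
  content n c b                       ∎
  where open ≡-Reasoning

extend : Fin k → Coloring n k → ℕ → Fin k
extend a []      _       = a
extend a (b ∷ f) zero    = b
extend a (b ∷ f) (suc u) = extend a f u

extend-represents : (a : Fin k) (f : Coloring n k) → Represents (extend a f) f
extend-represents a (b ∷ f) zero    = refl
extend-represents a (b ∷ f) (suc u) = extend-represents a f u

monomials : (Coloring n k → Exponent k) → List (Coloring n k) → Polynomial k
monomials w = List.map (λ f → (1ℤ , w f))

module _ (w : Coloring n k → Exponent k) (α : Exponent k) where

  -- All coefficients are 1, so collecting like terms counts colourings and nothing cancels. One
  -- colouring of weight `α` then puts `α` into the support.
  coeff-monomials : ∀ fs → ∃[ m ] coeff (monomials w fs) α ≡ ℤ.+ m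
  coeff-monomials []       = 0 , refl
  coeff-monomials (f ∷ fs) with Vec.≡-dec _≟_ (w f) α | coeff-monomials fs
  ... | yes _ | m , eq rewrite eq = suc m , refl
  ... | no _  | m , eq rewrite eq = m , refl

  coeff-monomials-≢0 : ∀ {f fs} → f ∈ₗ fs → w f ≡ α → coeff (monomials w fs) α ≢ 0ℤ
  coeff-monomials-≢0 {fs = g ∷ fs} f∈ wf≡α with Vec.≡-dec _≟_ (w g) α | coeff-monomials fs | f∈
  ... | yes _    | m , eq | _          rewrite eq = λ ()
  ... | no wg≢α  | _      | here refl  = contradiction wf≡α wg≢α
  ... | no _     | _      | there f∈fs = λ eq₀ → coeff-monomials-≢0 f∈fs wf≡α (trans (sym (ℤ.+-identityˡ _)) eq₀)

  coeff-monomials-≢0⁻ : ∀ fs → coeff (monomials w fs) α ≢ 0ℤ → ∃[ f ] (f ∈ₗ fs × w f ≡ α)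
  coeff-monomials-≢0⁻ []       ≢0 = contradiction refl ≢0
  coeff-monomials-≢0⁻ (f ∷ fs) ≢0 with Vec.≡-dec _≟_ (w f) α
  ... | yes wf≡α = f , here refl , wf≡α
  ... | no  _    with coeff-monomials-≢0⁻ fs (≢0 ∘ trans (ℤ.+-identityˡ _))
  ...   | g , g∈ , eq = g , there g∈ , eq

∈-allColorings : (f : Coloring n k) → f ∈ₗ allColorings n k
∈-allColorings []      = here refl
∈-allColorings (a ∷ f) = ∈-cartesianProductWith⁺ _∷_ (∈-allFin a) (∈-allColorings f)

module _ (G : Graph n) where

  chromatic-monomials : chromaticSymmetricPolynomial G k ≡ monomials weight (filter (proper? G) (allColorings n k))
  chromatic-monomials {k = k} = go (filter (proper? G) (allColorings n k))
    where
    go : (fs : List (Coloring n k)) →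
         Σᴾ (List.map (λ f → Πᴾ (List.map (λ v → x (lookup f v)) (allFin n))) fs) ≡ monomials weight fs
    go []       = refl
    go (f ∷ fs) rewrite Πᴾ-weight f = cong (_ ∷_) (go fs)

  supp-chromatic⁺ : {α : Exponent k} (f : Coloring n k) → Proper G f → weight f ≡ α →
                    α ∈ supp (chromaticSymmetricPolynomial G k)
  supp-chromatic⁺ {α = α} f prop eq = subst (λ p → α ∈ supp p) (sym chromatic-monomials)
    (coeff-monomials-≢0 weight α (∈-filter⁺ (proper? G) (∈-allColorings f) prop) eq)

  supp-chromatic⁻ : {α : Exponent k} → α ∈ supp (chromaticSymmetricPolynomial G k) →
                    ∃[ f ] (Proper G f × weight f ≡ α)
  supp-chromatic⁻ {k = k} {α} α∈
    with coeff-monomials-≢0⁻ weight α (filter (proper? G) (allColorings n k))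
           (subst (λ p → α ∈ supp p) chromatic-monomials α∈)
  ... | f , f∈ , eq = f , proj₂ (∈-filter⁻ (proper? G) {xs = allColorings n k} f∈) , eq

-- Indifference graphs of Dyck paths as interval graphs.

𝗇-before-𝖾-mono : ∀ w {u v} → u ≤ v → 𝗇-before-𝖾 w u ≤ 𝗇-before-𝖾 w v
𝗇-before-𝖾-mono []      u≤v       = z≤n
𝗇-before-𝖾-mono (𝗇 ∷ w) u≤v       = s≤s (𝗇-before-𝖾-mono w u≤v)
𝗇-before-𝖾-mono (𝖾 ∷ w) z≤n       = z≤n
𝗇-before-𝖾-mono (𝖾 ∷ w) (s≤s u≤v) = 𝗇-before-𝖾-mono w u≤v

module _ (d : DyckPath n) where

  open Interval (𝗇-before-𝖾 (DyckPath.steps d)) (𝗇-before-𝖾-mono (DyckPath.steps d))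

  proper⇒proper< : (c : ℕ → Fin k) (f : Coloring n k) → Represents c f →
                   Proper (indifferenceGraph d) f → Proper< n c
  proper⇒proper< c f rep prop {u} {v} u<v v<n v<Hu cu≡cv =
    prop (fromℕ< u<n) (fromℕ< v<n)
      (inj₁ (subst₂ _<_ (sym u≡) (sym v≡) u<v ,
             subst₂ (λ a b → a < 𝗇-before-𝖾 (DyckPath.steps d) b) (sym v≡) (sym u≡) v<Hu))
      (begin
        lookup f (fromℕ< u<n)    ≡⟨ rep _ ⟩
        c (toℕ (fromℕ< u<n))     ≡⟨ cong c u≡ ⟩
        c u                      ≡⟨ cu≡cv ⟩
        c v                      ≡⟨ cong c v≡ ⟨
        c (toℕ (fromℕ< v<n))     ≡⟨ rep _ ⟨
        lookup f (fromℕ< v<n)    ∎)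
    where
    open ≡-Reasoning
    u<n = <-trans u<v v<n
    u≡ = Fin.toℕ-fromℕ< u<n
    v≡ = Fin.toℕ-fromℕ< v<n

  proper<⇒proper : (c : ℕ → Fin k) (f : Coloring n k) → Represents c f →
                   Proper< n c → Proper (indifferenceGraph d) f
  proper<⇒proper c f rep prop u v (inj₁ (u<v , v<Hu)) eq =
    prop u<v (Fin.toℕ<n v) v<Hu (trans (sym (rep u)) (trans eq (rep v)))
  proper<⇒proper c f rep prop u v (inj₂ (v<u , u<Hv)) eq =
    prop v<u (Fin.toℕ<n u) u<Hv (trans (sym (rep v)) (trans (sym eq) (rep u)))

  supp⇒realizable : Fin k → {α : Exponent k} → α ∈ supp (chromaticSymmetricPolynomial (indifferenceGraph d) k) →
                    Realizable n (lookup α)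
  supp⇒realizable a α∈ with supp-chromatic⁻ (indifferenceGraph d) α∈
  ... | f , prop , refl =
    -- The colour `a` is the default value for arguments from `n` on.
    extend a f , proper⇒proper< (extend a f) f rep prop , (λ b → sym (lookup-weight (extend a f) f rep b))
    where rep = extend-represents a f

  realizable⇒supp : {α : Exponent k} → Realizable n (lookup α) →
                    α ∈ supp (chromaticSymmetricPolynomial (indifferenceGraph d) k)
  realizable⇒supp {α = α} (c , prop , eq) =
    supp-chromatic⁺ (indifferenceGraph d) f (proper<⇒proper c f rep prop)
      (lookup-injective (λ b → trans (lookup-weight c f rep b) (eq b)))
    where
    f = tabulate (c ∘ toℕ)
    rep : Represents c f
    rep = Vec.lookup∘tabulate (c ∘ toℕ)

corollary4p3 : ∀ (n : ℕ) (d : DyckPath n) (k : ℕ) → k ≥ 1 →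
    MConvex (supp (chromaticSymmetricPolynomial (indifferenceGraph d) k))
corollary4p3 n d k _ α β α∈ β∈ i αi>βi =
  let j , αj<βj , realizable =
        exchange (Realizable n) Realizable-resp Realizable-transferable
          (λ Jα Jβ → trans (Realizable-total Jα) (sym (Realizable-total Jβ)))
          (λ σ → Realizable-greedy σ)
          -- The given colour `i` serves as the default colour.
          (supp⇒realizable d i α∈) (supp⇒realizable d i β∈) i αi>βi
  in j , αj<βj , realizable⇒supp d (realizable (lookup-move α i j (≤-trans (s≤s z≤n) αi>βi)))
  where open Interval (𝗇-before-𝖾 (DyckPath.steps d)) (𝗇-before-𝖾-mono (DyckPath.steps d))
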